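{- Let $G$ be a graph with $m\ge 1$ edges. Then $$HM_1(G)\ge \frac{M_1(G)^2}{m},$$ and equality holds if and only if $G$ is edge degree regular.
   Context: Graphs are finite, without loops or multiple edges. For a vertex $u$, $d(u)$ is its degree. For an edge $e=uv$ the edge degree is $d(e)=d(u)+d(v)$. The first Zagreb index is $M_1(G)=\sum_{v\in V(G)}d(v)^2$. The first hyper-Zagreb index is $HM_1(G)=\sum_{e\in E(G)}d(e)^2$. A graph is edge degree regular if all its edges have the same edge degree $d(e)$. -}

module Defs where

open import Data.Fin using (Fin)
open import Data.Fin.Properties using (_<?_)
open import Data.Integer using (+_)
open import Data.List using (List; allFin; cartesianProduct; filter; length; map)
open import Data.Nat using (ℕ; _+_; _^_)
open import Data.Nat.ListAction using (sum)
open import Data.Product using (_×_; _,_)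
open import Data.Rational using (ℚ; _/_)
open import Level using (0ℓ)
open import Relation.Binary.Core using (Rel)
open import Relation.Binary.Definitions using (Decidable; Irreflexive; Symmetric)
open import Relation.Binary.PropositionalEquality using (_≡_)
open import Relation.Nullary.Decidable using (_×-dec_)

record Graph (n : ℕ) : Set₁ where
  infix 4 _~_ _~?_
  field
    _~_    : Rel (Fin n) 0ℓ
    _~?_   : Decidable _~_
    sym    : Symmetric _~_
    irrefl : Irreflexive _≡_ _~_

module _ {n : ℕ} (G : Graph n) where
  open Graph G

  degree : Fin n → ℕ
  degree u = length (filter (u ~?_) (allFin n))

  -- Each edge {u, v} is listed exactly once, as the pair (u , v) with u < v.
  edges : List (Fin n × Fin n)
  edges = filter (λ (u , v) → (u <? v) ×-dec (u ~? v))
                 (cartesianProduct (allFin n) (allFin n))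

  size : ℕ
  size = length edges

  edgeDegree : Fin n × Fin n → ℕ
  edgeDegree (u , v) = degree u + degree v

  M₁ : ℕ
  M₁ = sum (map (λ v → degree v ^ 2) (allFin n))

  HM₁ : ℕ
  HM₁ = sum (map (λ e → edgeDegree e ^ 2) edges)

  EdgeDegreeRegular : Set
  EdgeDegreeRegular = ∀ {u v x y} → u ~ v → x ~ y →
                      edgeDegree (u , v) ≡ edgeDegree (x , y)

fromℕ : ℕ → ℚ
fromℕ k = + k / 1

{-# OPTIONS --safe #-}
-- Apply Cauchy–Schwarz to the edge degrees, in the form of Lagrange's identity
--   2 m Σ d(e)² = 2 (Σ d(e))² + Σ (d(e) − d(e′))²,
-- where the last sum is over all ordered pairs of edges and so vanishes exactly when all
-- edge degrees agree.  Counting incidences, Σ d(e) = Σ d(v) · d(v) = M₁.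
module Submission where

open import Data.Bool using (true; false; if_then_else_)
open import Data.Fin as Fin using (Fin)
open import Data.Fin.Properties using (_<?_; <-cmp)
open import Data.Integer as ℤ using (+_)
import Data.Integer.Properties as ℤ
open import Data.List using (List; []; _∷_; _++_; allFin; cartesianProduct; filter; length; map)
open import Data.List.Membership.Propositional using (_∈_)
open import Data.List.Membership.Propositional.Properties
  using (∈-allFin; ∈-cartesianProduct⁺; ∈-filter⁺; ∈-filter⁻)
open import Data.List.Properties using (map-++; map-∘)
open import Data.List.Relation.Unary.Any using (here; there)
open import Data.Nat using (ℕ; NonZero; suc; _+_; _*_; _^_; _≤_; ∣_-_∣)
open import Data.Nat.ListAction using (sum)
open import Data.Nat.ListAction.Properties using (sum-++)
open import Data.Nat.Properties hiding (_<?_; <-cmp)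
open import Data.Nat.Tactic.RingSolver using (solve-∀)
open import Data.Product using (_×_; _,_; ∃-syntax; proj₁; proj₂)
open import Data.Rational using (_/_; _≥_)
open import Data.Rational.Properties
  using (fromℚᵘ-cong; fromℚᵘ-injective; toℚᵘ-cancel-≤; toℚᵘ-fromℚᵘ)
open import Data.Rational.Unnormalised as ℚᵘ using (mkℚᵘ; *≡*; *≤*)
import Data.Rational.Unnormalised.Properties as ℚᵘ
open import Data.Sum using (inj₁; inj₂)
open import Function using (_∘_; case_of_)
open import Function.Bundles using (_⇔_; mk⇔)
open import Function.Construct.Composition using (_⇔-∘_)
open import Level using (Level)
open import Relation.Binary.Definitions using (tri<; tri≈; tri>)
open import Relation.Binary.PropositionalEquality
open import Relation.Nullary using (Dec; yes; no; does; ¬_; contradiction)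
open import Relation.Nullary.Decidable using (_×-dec_; dec-true; dec-false)
open import Relation.Unary using (Pred; Decidable)
open import Defs

private
  variable
    a b p : Level
    A : Set a
    B : Set b

-- Finite sums of natural numbers over lists, and indicators.

∑ : List A → (A → ℕ) → ℕ
∑ xs f = sum (map f xs)

syntax ∑ xs (λ x → e) = ∑[ x ← xs ] e

∑-cong : ∀ (xs : List A) {f g : A → ℕ} → (∀ x → f x ≡ g x) → ∑ xs f ≡ ∑ xs g
∑-cong []       f≗g = refl
∑-cong (x ∷ xs) f≗g = cong₂ _+_ (f≗g x) (∑-cong xs f≗g)

∑-+ : ∀ (xs : List A) (f g : A → ℕ) → ∑[ x ← xs ] (f x + g x) ≡ ∑ xs f + ∑ xs g
∑-+ []       f g = refl
∑-+ (x ∷ xs) f g = trans (cong₂ _+_ refl (∑-+ xs f g)) (medial (f x) (g x) (∑ xs f) (∑ xs g))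
  where
  medial : ∀ k l m n → (k + l) + (m + n) ≡ (k + m) + (l + n)
  medial = solve-∀

∑-*ˡ : ∀ (xs : List A) c (f : A → ℕ) → ∑[ x ← xs ] (c * f x) ≡ c * ∑ xs f
∑-*ˡ []       c f = sym (*-zeroʳ c)
∑-*ˡ (x ∷ xs) c f = trans (cong₂ _+_ refl (∑-*ˡ xs c f)) (sym (*-distribˡ-+ c (f x) (∑ xs f)))

∑-*ʳ : ∀ (xs : List A) (f : A → ℕ) c → ∑[ x ← xs ] (f x * c) ≡ ∑ xs f * c
∑-*ʳ xs f c = begin
  ∑[ x ← xs ] (f x * c) ≡⟨ ∑-cong xs (λ x → *-comm (f x) c) ⟩
  ∑[ x ← xs ] (c * f x) ≡⟨ ∑-*ˡ xs c f ⟩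
  c * ∑ xs f            ≡⟨ *-comm c (∑ xs f) ⟩
  ∑ xs f * c            ∎
  where open ≡-Reasoning

∑-const : ∀ (xs : List A) c → ∑[ _ ← xs ] c ≡ length xs * c
∑-const []       c = refl
∑-const (x ∷ xs) c = cong₂ _+_ refl (∑-const xs c)

∑-++ : ∀ (xs ys : List A) (f : A → ℕ) → ∑ (xs ++ ys) f ≡ ∑ xs f + ∑ ys f
∑-++ xs ys f = trans (cong sum (map-++ f xs ys)) (sum-++ (map f xs) (map f ys))

∑-swap : ∀ (xs : List A) (ys : List B) (f : A → B → ℕ) →
         ∑[ x ← xs ] ∑[ y ← ys ] f x y ≡ ∑[ y ← ys ] ∑[ x ← xs ] f x y
∑-swap []       ys f = sym (trans (∑-const ys 0) (*-zeroʳ (length ys)))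
∑-swap (x ∷ xs) ys f = trans (cong₂ _+_ refl (∑-swap xs ys f)) (sym (∑-+ ys (f x) _))

∑-cartesianProduct : ∀ (xs : List A) (ys : List B) (f : A × B → ℕ) →
                     ∑ (cartesianProduct xs ys) f ≡ ∑[ x ← xs ] ∑[ y ← ys ] f (x , y)
∑-cartesianProduct []       ys f = refl
∑-cartesianProduct (x ∷ xs) ys f = trans
  (∑-++ (map (x ,_) ys) (cartesianProduct xs ys) f)
  (cong₂ _+_ (cong sum (sym (map-∘ ys))) (∑-cartesianProduct xs ys f))

∑≡0⁺ : ∀ (xs : List A) {f : A → ℕ} → (∀ {x} → x ∈ xs → f x ≡ 0) → ∑ xs f ≡ 0
∑≡0⁺ []       f≡0 = refl
∑≡0⁺ (x ∷ xs) f≡0 = cong₂ _+_ (f≡0 (here refl)) (∑≡0⁺ xs (f≡0 ∘ there))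

∑≡0⁻ : ∀ (xs : List A) {f : A → ℕ} → ∑ xs f ≡ 0 → ∀ {x} → x ∈ xs → f x ≡ 0
∑≡0⁻ (x ∷ xs) {f} ∑≡0 (here refl)  = m+n≡0⇒m≡0 (f x) ∑≡0
∑≡0⁻ (x ∷ xs) {f} ∑≡0 (there x∈xs) = ∑≡0⁻ xs (m+n≡0⇒n≡0 (f x) ∑≡0) x∈xs

-- The Iverson bracket. It is read off from `does`, the Boolean that also decides `filter`, so a
-- single case split on it makes both sides of `∑-filter` compute.
𝟙 : {P : Set p} → Dec P → ℕ
𝟙 P? = if does P? then 1 else 0

𝟙-yes : {P : Set p} (P? : Dec P) → P → 𝟙 P? ≡ 1
𝟙-yes P? p = cong (if_then 1 else 0) (dec-true P? p)

𝟙-no : {P : Set p} (P? : Dec P) → ¬ P → 𝟙 P? ≡ 0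
𝟙-no P? ¬p = cong (if_then 1 else 0) (dec-false P? ¬p)

∑-filter : {P : Pred A p} (P? : Decidable P) (xs : List A) (f : A → ℕ) →
           ∑ (filter P? xs) f ≡ ∑[ x ← xs ] (𝟙 (P? x) * f x)
∑-filter P? []       f = refl
∑-filter P? (x ∷ xs) f with does (P? x)
... | true  = cong₂ _+_ (sym (*-identityˡ (f x))) (∑-filter P? xs f)
... | false = ∑-filter P? xs f

length-filter-∑ : {P : Pred A p} (P? : Decidable P) (xs : List A) →
                  length (filter P? xs) ≡ ∑[ x ← xs ] 𝟙 (P? x)
length-filter-∑ P? []       = refl
length-filter-∑ P? (x ∷ xs) with does (P? x)
... | true  = cong suc (length-filter-∑ P? xs)
... | false = length-filter-∑ P? xs

-- Lagrange's identity and Cauchy-Schwarz over the naturals.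

m²+n²≡2mn+∣m-n∣² : ∀ m n → m ^ 2 + n ^ 2 ≡ 2 * (m * n) + ∣ m - n ∣ ^ 2
m²+n²≡2mn+∣m-n∣² m n with ≤-total m n
-- The larger number is written as the smaller plus `k`, so the goal becomes a semiring identity
-- without subtraction.
... | inj₁ m≤n with k , refl ← m≤n⇒∃[o]m+o≡n m≤n =
  trans (square m k) (cong (λ d → 2 * (m * (m + k)) + d ^ 2) (sym (∣m-m+n∣≡n m k)))
  where
  -- The ring solver does not interpret _^_, so squares are unfolded in its goals.
  square : ∀ m k → m * (m * 1) + (m + k) * ((m + k) * 1) ≡ 2 * (m * (m + k)) + k * (k * 1)
  square = solve-∀
... | inj₂ n≤m with k , refl ← m≤n⇒∃[o]m+o≡n n≤m =
  trans (square n k) (cong (λ d → 2 * ((n + k) * n) + d ^ 2) (sym (∣m+n-m∣≡n n k)))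
  where
  square : ∀ n k → (n + k) * ((n + k) * 1) + n * (n * 1) ≡ 2 * ((n + k) * n) + k * (k * 1)
  square = solve-∀
  ∣m+n-m∣≡n : ∀ m n → ∣ m + n - m ∣ ≡ n
  ∣m+n-m∣≡n m n = trans (∣-∣-comm (m + n) m) (∣m-m+n∣≡n m n)

module _ (xs : List A) (f : A → ℕ) where

  deviation : ℕ
  deviation = ∑[ x ← xs ] ∑[ y ← xs ] (∣ f x - f y ∣ ^ 2)

  -- For fixed `x`, `row` sums the expansion of `f x ^ 2 + f y ^ 2` over `y`; summing the rows over
  -- `x` gives the identity. The factor 2 stays because the double sum meets every pair of distinct
  -- positions twice.
  lagrange : 2 * (∑[ x ← xs ] (f x ^ 2) * length xs) ≡ 2 * ∑ xs f ^ 2 + deviation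
  lagrange = begin
    2 * (Q * m)
      ≡⟨ twice Q m ⟩
    m * Q + m * Q
      ≡⟨ cong₂ _+_ (∑-*ˡ xs m _) (∑-const xs Q) ⟨
    ∑[ x ← xs ] (m * f x ^ 2) + ∑[ x ← xs ] Q
      ≡⟨ ∑-+ xs _ _ ⟨
    ∑[ x ← xs ] (m * f x ^ 2 + Q)
      ≡⟨ ∑-cong xs row ⟩
    ∑[ x ← xs ] (2 * S * f x + ∑[ y ← xs ] (∣ f x - f y ∣ ^ 2))
      ≡⟨ ∑-+ xs _ _ ⟩
    ∑[ x ← xs ] (2 * S * f x) + deviation
      ≡⟨ cong (_+ deviation) (trans (∑-*ˡ xs (2 * S) f) (square S)) ⟩
    2 * S ^ 2 + deviation
      ∎
    where
    open ≡-Reasoning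
    m = length xs
    S = ∑ xs f
    Q = ∑[ x ← xs ] (f x ^ 2)

    twice : ∀ q m → 2 * (q * m) ≡ m * q + m * q
    twice = solve-∀

    square : ∀ s → 2 * s * s ≡ 2 * (s * (s * 1))
    square = solve-∀

    rearrange : ∀ k l → 2 * (k * l) ≡ 2 * k * l
    rearrange = solve-∀

    rotate : ∀ k s → 2 * k * s ≡ 2 * s * k
    rotate = solve-∀

    row : ∀ x → m * f x ^ 2 + Q ≡ 2 * S * f x + ∑[ y ← xs ] (∣ f x - f y ∣ ^ 2)
    row x = begin
      m * f x ^ 2 + Q
        ≡⟨ cong (_+ Q) (∑-const xs (f x ^ 2)) ⟨
      ∑[ y ← xs ] (f x ^ 2) + Q
        ≡⟨ ∑-+ xs _ _ ⟨
      ∑[ y ← xs ] (f x ^ 2 + f y ^ 2)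
        ≡⟨ ∑-cong xs (λ y → trans (m²+n²≡2mn+∣m-n∣² (f x) (f y))
             (cong (_+ ∣ f x - f y ∣ ^ 2) (rearrange (f x) (f y)))) ⟩
      ∑[ y ← xs ] (2 * f x * f y + ∣ f x - f y ∣ ^ 2)
        ≡⟨ ∑-+ xs _ _ ⟩
      ∑[ y ← xs ] (2 * f x * f y) + ∑[ y ← xs ] (∣ f x - f y ∣ ^ 2)
        ≡⟨ cong₂ _+_ (trans (∑-*ˡ xs (2 * f x) f) (rotate (f x) S)) refl ⟩
      2 * S * f x + ∑[ y ← xs ] (∣ f x - f y ∣ ^ 2)
        ∎

  deviation≡0⁺ : (∀ x y → x ∈ xs → y ∈ xs → f x ≡ f y) → deviation ≡ 0
  deviation≡0⁺ const = ∑≡0⁺ xs λ x∈xs → ∑≡0⁺ xs λ y∈xs →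
    cong (_^ 2) (m≡n⇒∣m-n∣≡0 (const _ _ x∈xs y∈xs))

  -- A sum of naturals vanishes only termwise; this is used for the outer sum, then for the inner
  -- one.
  deviation≡0⁻ : deviation ≡ 0 → ∀ x y → x ∈ xs → y ∈ xs → f x ≡ f y
  deviation≡0⁻ dev≡0 _ _ x∈xs y∈xs =
    ∣m-n∣≡0⇒m≡n (m^n≡0⇒m≡0 _ 2 (∑≡0⁻ xs (∑≡0⁻ xs dev≡0 x∈xs) y∈xs))

  cauchy-schwarz : ∑ xs f ^ 2 ≤ ∑[ x ← xs ] (f x ^ 2) * length xs
  cauchy-schwarz = *-cancelˡ-≤ 2 (subst (2 * ∑ xs f ^ 2 ≤_) (sym lagrange) (m≤m+n _ deviation))

  cauchy-schwarz-≡ : ∑[ x ← xs ] (f x ^ 2) * length xs ≡ ∑ xs f ^ 2 ⇔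
                     (∀ x y → x ∈ xs → y ∈ xs → f x ≡ f y)
  cauchy-schwarz-≡ = mk⇔
    (λ eq → deviation≡0⁻ (+-cancelˡ-≡ (2 * ∑ xs f ^ 2) _ _
      (trans (sym lagrange) (trans (cong (2 *_) eq) (sym (+-identityʳ _))))))
    (λ const → *-cancelˡ-≡ _ _ 2
      (trans lagrange (trans (cong₂ _+_ refl (deviation≡0⁺ const)) (+-identityʳ _))))

-- Counting incidences, and edges as ordered pairs.

module _ {n : ℕ} (G : Graph n) where
  open Graph G renaming (sym to ~-sym)

  private
    V : List (Fin n)
    V = allFin n

    edge? : ∀ u v → Dec _
    edge? u v = (u <? v) ×-dec (u ~? v)

  -- By trichotomy, adjacent vertices are listed in exactly one of their two orders; irreflexivity
  -- excludes `u ≡ v`.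
  𝟙-orient : ∀ u v → 𝟙 (edge? u v) + 𝟙 (edge? v u) ≡ 𝟙 (u ~? v)
  𝟙-orient u v with u ~? v
  -- The case split has replaced `u ~? v` inside `edge? u v`, which is therefore written out, while
  -- `edge? v u` still contains its own test `v ~? u`.
  ... | no u≁v = cong₂ _+_
    (𝟙-no ((u <? v) ×-dec no u≁v) (u≁v ∘ proj₂))
    (𝟙-no (edge? v u) (u≁v ∘ ~-sym ∘ proj₂))
  ... | yes u~v with <-cmp u v
  ...   | tri< u<v _ v≮u = cong₂ _+_
    (𝟙-yes ((u <? v) ×-dec yes u~v) (u<v , u~v))
    (𝟙-no (edge? v u) (v≮u ∘ proj₁))
  ...   | tri≈ _ u≡v _ = contradiction u~v (irrefl u≡v)
  ...   | tri> u≮v _ v<u = cong₂ _+_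
    (𝟙-no ((u <? v) ×-dec yes u~v) (u≮v ∘ proj₁))
    (𝟙-yes (edge? v u) (v<u , ~-sym u~v))

  -- Double counting: each edge gives the weight of each end once, so a vertex is counted once per
  -- incident edge. Indicators extend the sum to all ordered pairs of vertices.
  incidence : ∀ (f : Fin n → ℕ) →
              ∑ (edges G) (λ (u , v) → f u + f v) ≡ ∑[ v ← V ] (degree G v * f v)
  incidence f = begin
    ∑ (edges G) (λ (u , v) → f u + f v)
      ≡⟨ ∑-filter (λ (u , v) → edge? u v) (cartesianProduct V V) _ ⟩
    ∑ (cartesianProduct V V) (λ (u , v) → 𝟙 (edge? u v) * (f u + f v))
      ≡⟨ ∑-cartesianProduct V V _ ⟩
    ∑[ u ← V ] ∑[ v ← V ] (𝟙 (edge? u v) * (f u + f v))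
      ≡⟨ ∑-cong V (λ u → trans
           (∑-cong V (λ v → *-distribˡ-+ (𝟙 (edge? u v)) (f u) (f v)))
           (∑-+ V _ _)) ⟩
    ∑[ u ← V ] (∑[ v ← V ] (𝟙 (edge? u v) * f u) + ∑[ v ← V ] (𝟙 (edge? u v) * f v))
      ≡⟨ ∑-+ V _ _ ⟩
    ∑[ u ← V ] ∑[ v ← V ] (𝟙 (edge? u v) * f u) + ∑[ u ← V ] ∑[ v ← V ] (𝟙 (edge? u v) * f v)
      -- Exchanging the summations moves the weight of the larger end to the outer variable, so both
      -- sums share the factor `f u` and `𝟙-orient` can merge their indicators.
      ≡⟨ cong₂ _+_ refl (∑-swap V V _) ⟩
    ∑[ u ← V ] ∑[ v ← V ] (𝟙 (edge? u v) * f u) + ∑[ u ← V ] ∑[ v ← V ] (𝟙 (edge? v u) * f u)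
      ≡⟨ ∑-+ V _ _ ⟨
    ∑[ u ← V ] (∑[ v ← V ] (𝟙 (edge? u v) * f u) + ∑[ v ← V ] (𝟙 (edge? v u) * f u))
      ≡⟨ ∑-cong V (λ u → trans (sym (∑-+ V _ _)) (∑-cong V (λ v →
           trans (sym (*-distribʳ-+ (f u) (𝟙 (edge? u v)) (𝟙 (edge? v u))))
                 (cong (_* f u) (𝟙-orient u v))))) ⟩
    ∑[ u ← V ] ∑[ v ← V ] (𝟙 (u ~? v) * f u)
      ≡⟨ ∑-cong V (λ u → trans (∑-*ʳ V _ (f u))
           (cong (_* f u) (sym (length-filter-∑ (u ~?_) V)))) ⟩
    ∑[ u ← V ] (degree G u * f u)
      ∎
    where open ≡-Reasoning

  ∑-edgeDegree : ∑ (edges G) (edgeDegree G) ≡ M₁ G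
  ∑-edgeDegree = trans (incidence (degree G))
    (∑-cong V (λ v → cong (degree G v *_) (sym (*-identityʳ (degree G v)))))

  ∈-edges⁻ : ∀ {u v} → (u , v) ∈ edges G → u ~ v
  ∈-edges⁻ e∈ = proj₂ (proj₂ (∈-filter⁻ (λ (u , v) → edge? u v) {xs = cartesianProduct V V} e∈))

  ∈-edges⁺ : ∀ {u v} → u Fin.< v → u ~ v → (u , v) ∈ edges G
  ∈-edges⁺ {u} {v} u<v u~v = ∈-filter⁺ (λ (u , v) → edge? u v)
    (∈-cartesianProduct⁺ (∈-allFin u) (∈-allFin v)) (u<v , u~v)

  -- Regularity speaks of adjacent pairs in either order, whereas `edges` lists only the increasing
  -- one. Reversing a pair keeps its edge degree.
  edge-with-degree : ∀ {u v} → u ~ v →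
                     ∃[ e ] e ∈ edges G × edgeDegree G e ≡ edgeDegree G (u , v)
  edge-with-degree {u} {v} u~v with <-cmp u v
  ... | tri< u<v _ _ = (u , v) , ∈-edges⁺ u<v u~v , refl
  ... | tri≈ _ u≡v _ = contradiction u~v (irrefl u≡v)
  ... | tri> _ _ v<u = (v , u) , ∈-edges⁺ v<u (~-sym u~v) , +-comm (degree G v) (degree G u)

  regular⇔ : (∀ e e′ → e ∈ edges G → e′ ∈ edges G → edgeDegree G e ≡ edgeDegree G e′) ⇔
             EdgeDegreeRegular G
  regular⇔ = mk⇔ to from
    where
    to : _ → EdgeDegreeRegular G
    to const u~v x~y
      with e , e∈ , e≡ ← edge-with-degree u~v | e′ , e′∈ , e′≡ ← edge-with-degree x~y =
      trans (sym e≡) (trans (const e e′ e∈ e′∈) e′≡)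
    from : EdgeDegreeRegular G → _
    from reg _ _ e∈ e′∈ = reg (∈-edges⁻ e∈) (∈-edges⁻ e′∈)

-- Clearing the denominator in the rational statements.

fromℕ-≥-/ : ∀ k l m .{{_ : NonZero m}} → l ≤ k * m → fromℕ k ≥ + l / m
-- `mkℚᵘ` stores the denominator minus one, so `mkℚᵘ (+ l) m` is `l` over `suc m` and `mkℚᵘ (+ k) 0`
-- is `k` over 1. Their order is by definition a comparison of cross products.
fromℕ-≥-/ k l (suc m) l≤km = toℚᵘ-cancel-≤
  (ℚᵘ.≤-respʳ-≃ (ℚᵘ.≃-sym (toℚᵘ-fromℚᵘ (mkℚᵘ (+ k) 0)))
    (ℚᵘ.≤-respˡ-≃ (ℚᵘ.≃-sym (toℚᵘ-fromℚᵘ (mkℚᵘ (+ l) m)))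
      (*≤* (subst₂ ℤ._≤_ (sym (ℤ.*-identityʳ (+ l))) (ℤ.pos-* k (suc m)) (ℤ.+≤+ l≤km)))))

-- Both sides are normal forms of unnormalised fractions, and two fractions share a normal form
-- exactly when their cross products agree.
fromℕ-≡-/ : ∀ k l m .{{_ : NonZero m}} → fromℕ k ≡ + l / m ⇔ k * m ≡ l
fromℕ-≡-/ k l (suc m) = mk⇔
  (λ eq → case fromℚᵘ-injective {mkℚᵘ (+ k) 0} {mkℚᵘ (+ l) m} eq of λ where
    (*≡* km≡l) → ℤ.+-injective (trans (ℤ.pos-* k (suc m)) (trans km≡l (ℤ.*-identityʳ (+ l)))))
  (λ km≡l → fromℚᵘ-cong {mkℚᵘ (+ k) 0} {mkℚᵘ (+ l) m}
    (*≡* (trans (sym (ℤ.pos-* k (suc m))) (trans (cong +_ km≡l) (sym (ℤ.*-identityʳ (+ l)))))))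

module _ {n : ℕ} (G : Graph n) where

  M₁²≤HM₁*size : M₁ G ^ 2 ≤ HM₁ G * size G
  -- `HM₁` and `size` match Cauchy-Schwarz by definition; only the sum of the edge degrees has to be
  -- rewritten as `M₁`.
  M₁²≤HM₁*size = subst (λ s → s ^ 2 ≤ HM₁ G * size G) (∑-edgeDegree G)
    (cauchy-schwarz (edges G) (edgeDegree G))

  HM₁*size≡M₁²⇔regular : HM₁ G * size G ≡ M₁ G ^ 2 ⇔ EdgeDegreeRegular G
  HM₁*size≡M₁²⇔regular = subst (λ s → HM₁ G * size G ≡ s ^ 2 ⇔ EdgeDegreeRegular G)
    (∑-edgeDegree G) (regular⇔ G ⇔-∘ cauchy-schwarz-≡ (edges G) (edgeDegree G))

theorem2 : ∀ {n : ℕ} (G : Graph n) .{{_ : NonZero (size G)}} →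
    (fromℕ (HM₁ G) ≥ + (M₁ G ^ 2) / size G)
    × ((fromℕ (HM₁ G) ≡ + (M₁ G ^ 2) / size G) ⇔ EdgeDegreeRegular G)
theorem2 G =
  fromℕ-≥-/ (HM₁ G) (M₁ G ^ 2) (size G) (M₁²≤HM₁*size G) ,
  HM₁*size≡M₁²⇔regular G ⇔-∘ fromℕ-≡-/ (HM₁ G) (M₁ G ^ 2) (size G)
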